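{- Let $L$ be a label set containing $a$, and let $\mathcal{D}$ be the category of finite rooted $L$-labeled transition systems with root-preserving, label-preserving homomorphisms. Call a sieve $S$ on an object $G$ naive-sim-covering if for every finite rooted $L$-labeled tree $T$ admitting a homomorphism $T\to G$, some homomorphism $T\to G$ belongs to $S$. Then this covering predicate satisfies the maximality and transitivity axioms of a Grothendieck topology but not the stability (pullback) axiom. Explicitly: let $\mathrm{traceLTS}[a]$ have vertices $0$ (root) and $1$ with edge $0\xrightarrow{a}1$; let $\mathrm{fanLTS}[a,a]$ have vertices $0$ (root), $1$, $2$ with edges $0\xrightarrow{a}1$ and $0\xrightarrow{a}2$; let $f_R,f_L:\mathrm{traceLTS}[a]\to\mathrm{fanLTS}[a,a]$ send $1$ to $2$ and to $1$ respectively. The sieve $S$ on $\mathrm{fanLTS}[a,a]$ generated by $f_R$ is naive-sim-covering, while its pullback $f_L^*(S)$ on $\mathrm{traceLTS}[a]$ is not naive-sim-covering.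
   Context: A sieve on $G$ is a set of morphisms with codomain $G$ closed under precomposition; the pullback $f^*(S)$ along $f:H\to G$ is $\{g : f\circ g\in S\}$. The Grothendieck topology axioms: the maximal sieve covers (maximality); covering sieves are stable under pullback (stability); and if $S$ covers and $R$ is a sieve such that $f^*(R)$ covers for every $f\in S$ then $R$ covers (transitivity). -}

module Defs where

open import Level using (Level; _⊔_; suc)
open import Data.Nat.Base using (ℕ)
open import Data.Fin.Base using (Fin)
open import Data.Fin.Patterns using (0F; 1F; 2F)
open import Data.List.Base using (List; []; _∷_; [_])
open import Data.List.Membership.Propositional using (_∈_)
open import Data.List.Relation.Unary.Any using (here; there)
open import Data.Product using (Σ; ∃!; ∃-syntax; _×_; _,_)
open import Data.Unit.Polymorphic using (⊤; tt)
open import Relation.Binary.PropositionalEquality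
  using (_≡_; refl; sym; trans; cong)
open import Relation.Binary.Structures using (IsEquivalence)

------------------------------------------------------------------------
-- Categories, sieves and the axioms of a Grothendieck topology

record Category (o h e : Level) : Set (suc (o ⊔ h ⊔ e)) where
  infix  4 _≈_
  infixr 9 _∘_
  field
    Obj       : Set o
    Hom       : Obj → Obj → Set h
    _≈_       : ∀ {A B} → Hom A B → Hom A B → Set e
    id        : ∀ {A} → Hom A A
    _∘_       : ∀ {A B C} → Hom B C → Hom A B → Hom A C
    ≈-equiv   : ∀ {A B} → IsEquivalence (_≈_ {A} {B})
    ∘-cong    : ∀ {A B C} {f f′ : Hom B C} {g g′ : Hom A B} →
                f ≈ f′ → g ≈ g′ → f ∘ g ≈ f′ ∘ g′
    identityˡ : ∀ {A B} (f : Hom A B) → id ∘ f ≈ f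
    identityʳ : ∀ {A B} (f : Hom A B) → f ∘ id ≈ f
    assoc     : ∀ {A B C D} (f : Hom C D) (g : Hom B C) (k : Hom A B) →
                (f ∘ g) ∘ k ≈ f ∘ (g ∘ k)

module Sieves {o h e : Level} (C : Category o h e) where
  open Category C

  -- Morphisms are compared by ≈, so a set of morphisms is a predicate
  -- respecting ≈.
  record Sieve (p : Level) (G : Obj) : Set (o ⊔ h ⊔ e ⊔ suc p) where
    field
      member : ∀ {H} → Hom H G → Set p
      resp   : ∀ {H} {f g : Hom H G} → f ≈ g → member f → member g
      closed : ∀ {H K} {f : Hom H G} → member f → (g : Hom K H) →
               member (f ∘ g)

  open Sieve

  infix 4 _∈ˢ_
  _∈ˢ_ : ∀ {p G H} → Hom H G → Sieve p G → Set p
  f ∈ˢ S = member S f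

  maximal : ∀ {p} (G : Obj) → Sieve p G
  maximal G .member _   = ⊤
  maximal G .resp _ _   = tt
  maximal G .closed _ _ = tt

  pullback : ∀ {p G H} → Hom H G → Sieve p G → Sieve p H
  pullback f S .member g       = f ∘ g ∈ˢ S
  pullback f S .resp g≈g′      =
    resp S (∘-cong (IsEquivalence.refl ≈-equiv) g≈g′)
  pullback f S .closed {f = g} fg∈S k =
    resp S (assoc f g k) (closed S fg∈S k)

  generatedBy : ∀ {G H} → Hom H G → Sieve (h ⊔ e) G
  generatedBy {H = H} f .member {K} g = Σ (Hom K H) λ k → g ≈ f ∘ k
  generatedBy f .resp g≈g′ (k , g≈fk) =
    k , IsEquivalence.trans ≈-equiv (IsEquivalence.sym ≈-equiv g≈g′) g≈fk
  generatedBy f .closed (k , g≈fk) l =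
    k ∘ l ,
    IsEquivalence.trans ≈-equiv
      (∘-cong g≈fk (IsEquivalence.refl ≈-equiv)) (assoc f k l)

  CoveringPredicate : (p c : Level) → Set (o ⊔ h ⊔ e ⊔ suc (p ⊔ c))
  CoveringPredicate p c = (G : Obj) → Sieve p G → Set c

  module _ {p c : Level} (Covers : CoveringPredicate p c) where

    Maximality : Set (o ⊔ c)
    Maximality = ∀ G → Covers G (maximal G)

    Stability : Set (o ⊔ h ⊔ e ⊔ suc p ⊔ c)
    Stability = ∀ {G H} (S : Sieve p G) → Covers G S →
                (f : Hom H G) → Covers H (pullback f S)

    Transitivity : Set (o ⊔ h ⊔ e ⊔ suc p ⊔ c)
    Transitivity = ∀ {G} (S : Sieve p G) → Covers G S → (R : Sieve p G) →
                   (∀ {H} (f : Hom H G) → f ∈ˢ S → Covers H (pullback f R)) →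
                   Covers G R

------------------------------------------------------------------------
-- Finite rooted labelled transition systems

module _ {ℓ : Level} (L : Set ℓ) where

  -- Finitely many vertices, finitely many transitions.  The list of
  -- transitions is only ever used through membership, so its order and
  -- repetitions are irrelevant.
  record LTS : Set ℓ where
    field
      size  : ℕ
      root  : Fin size
      edges : List (Fin size × L × Fin size)

    Vertex : Set
    Vertex = Fin size

    infix 4 _—[_]→_
    _—[_]→_ : Vertex → L → Vertex → Set ℓ
    s —[ l ]→ t = (s , l , t) ∈ edges

module _ {ℓ : Level} {L : Set ℓ} where

  record LTSHom (G H : LTS L) : Set ℓ where
    private
      module G = LTS G
      module H = LTS H
    field
      map      : G.Vertex → H.Vertex
      map-root : map G.root ≡ H.root
      map-edge : ∀ {s l t} → s G.—[ l ]→ t → map s H.—[ l ]→ map t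

  -- Walk G s w t: the word w lists the labels and target vertices of the
  -- successive transitions of a directed path from s to t.
  data Walk (G : LTS L) : LTS.Vertex G → List (L × LTS.Vertex G) →
                          LTS.Vertex G → Set ℓ where
    []  : ∀ {s} → Walk G s [] s
    _∷_ : ∀ {s l t w u} → LTS._—[_]→_ G s l t → Walk G t w u →
          Walk G s ((l , t) ∷ w) u

  -- Uniqueness concerns the word rather than the Walk itself, whose
  -- membership proofs need not be unique.
  IsTree : LTS L → Set ℓ
  IsTree T = (v : Vertex) → ∃! _≡_ λ w → Walk T root w v
    where open LTS T

LTSCategory : ∀ {ℓ} (L : Set ℓ) → Category _ _ _
LTSCategory {ℓ} L = record
  { Obj       = LTS L
  ; Hom       = LTSHom
  ; _≈_       = λ f g → ∀ v → map f v ≡ map g v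
  ; id        = record
    { map      = λ v → v
    ; map-root = refl
    ; map-edge = λ e → e
    }
  ; _∘_       = λ f g → record
    { map      = λ v → map f (map g v)
    ; map-root = trans (cong (map f) (map-root g)) (map-root f)
    ; map-edge = λ e → map-edge f (map-edge g e)
    }
  ; ≈-equiv   = record
    { refl  = λ v → refl
    ; sym   = λ p v → sym (p v)
    ; trans = λ p q v → trans (p v) (q v)
    }
  ; ∘-cong    = λ {_} {_} {_} {_} {f′} {g} p q v →
                trans (p (map g v)) (cong (map f′) (q v))
  ; identityˡ = λ f v → refl
  ; identityʳ = λ f v → refl
  ; assoc     = λ f g k v → refl
  }
  where open LTSHom

module _ {ℓ : Level} (L : Set ℓ) where
  open Sieves (LTSCategory L)

  NaiveSimCovering : CoveringPredicate ℓ ℓ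
  NaiveSimCovering G S =
    (T : LTS L) → IsTree T → LTSHom T G → ∃[ h ] (_∈ˢ_ {H = T} h S)

module _ {ℓ : Level} {L : Set ℓ} where

  traceLTS : L → LTS L
  traceLTS a = record
    { size  = 2
    ; root  = 0F
    ; edges = [ (0F , a , 1F) ]
    }

  fanLTS : L → L → LTS L
  fanLTS a b = record
    { size  = 3
    ; root  = 0F
    ; edges = (0F , a , 1F) ∷ (0F , b , 2F) ∷ []
    }

  fL : (a : L) → LTSHom (traceLTS a) (fanLTS a a)
  fL a = record
    { map      = λ { 0F → 0F ; 1F → 1F }
    ; map-root = refl
    ; map-edge = λ { (here refl) → here refl }
    }

  fR : (a : L) → LTSHom (traceLTS a) (fanLTS a a)
  fR a = record
    { map      = λ { 0F → 0F ; 1F → 2F }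
    ; map-root = refl
    ; map-edge = λ { (here refl) → there (here refl) }
    }

{-# OPTIONS --safe #-}
-- Maximality and transitivity hold because a covering sieve is tested on trees
-- T → G one at a time; for transitivity one tests the second cover at T itself,
-- with the identity.  The fan folds onto the trace, so every map to the fan can
-- be replaced by one through fR; but fL ∘ h never factors through fR, since a
-- map h between traces hits vertex 1, and 1 is not in the image of fR.
module Submission where

open import Defs
open import Level using (Level)
open import Data.Fin.Patterns using (0F; 1F; 2F)
open import Data.List.Base using ([]; _∷_)
open import Data.List.Relation.Unary.Any using (here; there)
open import Data.Product using (_×_; _,_)
open import Data.Unit.Polymorphic using (tt)
open import Relation.Binary.PropositionalEquality
  using (_≡_; _≢_; refl; sym; trans; cong)
open import Relation.Nullary using (¬_)

open LTSHom

module _ {ℓ : Level} (L : Set ℓ) where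
  open Category (LTSCategory L)
  open Sieves (LTSCategory L)

  naiveSim-maximality : Maximality (NaiveSimCovering L)
  naiveSim-maximality G T _ h = h , tt

  naiveSim-transitivity : Transitivity (NaiveSimCovering L)
  naiveSim-transitivity {G} S S-covers R R-covers T tree h =
    let f , f∈S  = S-covers T tree h
        -- The pullback of `R` along `f : T → G` is a sieve on `T`, so `k` is an endomorphism of `T`
        -- and `f ∘ k` still has domain `T`.
        k , fk∈R = R-covers f f∈S T tree (id {T})
    in _∘_ {T} {T} {G} f k , fk∈R

module _ {ℓ : Level} {L : Set ℓ} (a : L) where
  open Category (LTSCategory L)
  open Sieves (LTSCategory L)

  -- Lets the trace serve as its own test tree below. No transition leaves vertex 1, so a walk from
  -- the root has at most one step.
  traceLTS-isTree : IsTree (traceLTS a)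
  traceLTS-isTree 0F = [] , [] , unique
    where
    unique : ∀ {w} → Walk (traceLTS a) 0F w 0F → [] ≡ w
    unique [] = refl
    unique (here refl ∷ (here () ∷ _))
  traceLTS-isTree 1F = _ , here refl ∷ [] , unique
    where
    unique : ∀ {w} → Walk (traceLTS a) 0F w 1F → (a , 1F) ∷ [] ≡ w
    unique (here refl ∷ []) = refl
    unique (here refl ∷ (here () ∷ _))

  -- Possible because both branches of the fan carry the same label.
  fold : LTSHom (fanLTS a a) (traceLTS a)
  fold = record
    { map      = λ { 0F → 0F ; 1F → 1F ; 2F → 1F }
    ; map-root = refl
    ; map-edge = λ { (here refl) → here refl ; (there (here refl)) → here refl }
    }

  private
    rightSieve : Sieve ℓ (fanLTS a a)
    rightSieve = generatedBy {fanLTS a a} {traceLTS a} (fR a)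

  rightSieve-covers : NaiveSimCovering L (fanLTS a a) rightSieve
  rightSieve-covers T _ h =
    _∘_ {T} {traceLTS a} {fanLTS a a} (fR a) k , k , λ _ → refl
    where k = _∘_ {T} {fanLTS a a} {traceLTS a} fold h

  traceLTS-target : ∀ {s l t} → LTS._—[_]→_ (traceLTS a) s l t → t ≡ 1F
  traceLTS-target (here refl) = refl

  1∉image-fR : ∀ v → 1F ≢ map (fR a) v
  1∉image-fR 0F ()
  1∉image-fR 1F ()

  pullback-not-covering :
    ¬ NaiveSimCovering L (traceLTS a) (pullback {H = traceLTS a} (fL a) rightSieve)
  pullback-not-covering covers
    with h , k , fLh≈fRk ← covers (traceLTS a) traceLTS-isTree (id {traceLTS a}) =
    -- At vertex 1 the factorization reads `fL (h 1) ≡ fR (k 1)`, and its left side is 1.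
    1∉image-fR (map k 1F)
      (trans (sym (cong (map (fL a)) h1≡1)) (fLh≈fRk 1F))
    -- `h` must send the only transition of the trace to itself, which fixes its target.
    where h1≡1 = traceLTS-target (map-edge h (here refl))

  naiveSim-not-stable : ¬ Stability (NaiveSimCovering L)
  naiveSim-not-stable stable =
    pullback-not-covering (stable rightSieve rightSieve-covers (fL a))

mainTheorem17 : ∀ {ℓ : Level} (L : Set ℓ) (a : L) →
    let open Sieves (LTSCategory L)
        S = generatedBy {fanLTS a a} {traceLTS a} (fR a)
    in Maximality (NaiveSimCovering L)
     × Transitivity (NaiveSimCovering L)
     × ¬ Stability (NaiveSimCovering L)
     × NaiveSimCovering L (fanLTS a a) S
     × ¬ NaiveSimCovering L (traceLTS a) (pullback {H = traceLTS a} (fL a) S)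
mainTheorem17 L a =
    naiveSim-maximality L
  , naiveSim-transitivity L
  , naiveSim-not-stable a
  , rightSieve-covers a
  , pullback-not-covering a
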